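{- Let $b\ge 2$ be even and $n\ge 2$. Then $$g(SC^{+}(b,n)) = b + \frac{b^{2n}(b-1) + b^{n}(bn-n-1)}{2}.$$
   Context: For an even integer $b\ge2$ and $n\ge0$, $SC^{+}(b,n)=\langle\{b^{n+i}+1: i\in\mathbb{N}\}\rangle$ (submonoid of $(\mathbb{N},+)$ generated by these numbers, a numerical semigroup). The genus $g(S)$ is the cardinality of $\mathbb{N}\setminus S$. -}

module Defs where

open import Level using (0ℓ)
open import Data.List using (length)
open import Data.List.Membership.Propositional using () renaming (_∈_ to _∈ₗ_)
open import Data.List.Relation.Unary.Unique.Propositional using (Unique)
open import Data.Nat using (ℕ; _+_; _^_)
open import Data.Product using (_×_; ∃-syntax)
open import Function.Bundles using (_⇔_)
open import Relation.Binary.PropositionalEquality using (_≡_)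
open import Relation.Unary using (Pred; _∈_; _∉_)

data ⟨_⟩ (G : Pred ℕ 0ℓ) : Pred ℕ 0ℓ where
  gen  : ∀ {x} → x ∈ G → x ∈ ⟨ G ⟩
  zero : 0 ∈ ⟨ G ⟩
  add  : ∀ {x y} → x ∈ ⟨ G ⟩ → y ∈ ⟨ G ⟩ → x + y ∈ ⟨ G ⟩

SC⁺-generators : ℕ → ℕ → Pred ℕ 0ℓ
SC⁺-generators b n x = ∃[ i ] x ≡ b ^ (n + i) + 1

SC⁺ : ℕ → ℕ → Pred ℕ 0ℓ
SC⁺ b n = ⟨ SC⁺-generators b n ⟩

-- "ℕ ∖ S is finite of cardinality g": its elements can be listed without
-- repetition in a list of length g.  Such a g is unique, so this is the graph
-- of the partial function S ↦ g(S), and it includes the finiteness of ℕ ∖ S.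
HasGenus : Pred ℕ 0ℓ → ℕ → Set
HasGenus S g =
  ∃[ gaps ] Unique {A = ℕ} gaps × length gaps ≡ g × (∀ x → x ∈ₗ gaps ⇔ x ∉ S)

{-# OPTIONS --safe #-}

-- Put a = b − 1, q = b ^ n and L m = ⌊m/b⌋ + ⌊m/b²⌋ + ⋯.  A number m is a sum
-- of exactly k powers of b iff k = m − ac with c ≤ L m, so the elements of
-- SC⁺(b,n), which are the k + qm for such k and m, are the (q + 1)m − ac with
-- c ≤ L m.  As b is even, a and q + 1 are coprime, so every x is uniquely
-- (q + 1)t − ac with 0 ≤ c ≤ q, and x is a gap iff L t < c.  Hence row t holds
-- min(q, ⌊(q + 1)t/a⌋) − L t gaps, and there are none from t = aq + b on, since
-- L(aq + b) = q when n ≥ 2.  The two sums that remain follow from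
-- q ≡ 1 (mod a) and from L(d + mb) = m + L m for d < b.
module Submission where

open import Data.List using (List; []; _++_; applyUpTo; length)
open import Data.List.Membership.Propositional using () renaming (_∈_ to _∈ₗ_)
open import Data.List.Membership.Propositional.Properties using (∈-++⁺ˡ; ∈-++⁺ʳ; ∈-++⁻; ∈-applyUpTo⁺; ∈-applyUpTo⁻)
open import Data.List.Properties using (length-++; length-applyUpTo)
open import Data.List.Relation.Unary.AllPairs using ([])
open import Data.List.Relation.Unary.Unique.Propositional using (Unique)
open import Data.List.Relation.Unary.Unique.Propositional.Properties using (++⁺; applyUpTo⁺₁)
open import Data.Nat
open import Data.Nat.Coprimality using (Coprime; coprime-divisor)
open import Data.Nat.DivMod
open import Data.Nat.Divisibility
open import Data.Nat.Induction using (<-rec)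
open import Data.Nat.Properties
open import Data.Nat.Tactic.RingSolver using (solve-∀)
open import Data.Product using (_×_; _,_; ∃-syntax; proj₁; proj₂)
open import Data.Sum using (inj₁; inj₂)
open import Function.Bundles using (mk⇔)
open import Relation.Binary.PropositionalEquality
open import Relation.Nullary using (yes; no; contradiction)
open import Relation.Unary using (_∈_; _∉_)
open import Defs

-- Finite sums over initial segments.

∑ : ℕ → (ℕ → ℕ) → ℕ
∑ zero    f = 0
∑ (suc n) f = ∑ n f + f n

∑-cong : ∀ n {f g} → (∀ i → i < n → f i ≡ g i) → ∑ n f ≡ ∑ n g
∑-cong zero    f≡g = refl
∑-cong (suc n) f≡g = cong₂ _+_ (∑-cong n (λ i i<n → f≡g i (m<n⇒m<1+n i<n))) (f≡g n ≤-refl)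

∑-+ : ∀ n f g → ∑ n (λ i → f i + g i) ≡ ∑ n f + ∑ n g
∑-+ zero    f g = refl
∑-+ (suc n) f g = trans (cong (_+ (f n + g n)) (∑-+ n f g)) (lemma (∑ n f) (∑ n g) (f n) (g n))
  where
  lemma : ∀ w x y z → (w + x) + (y + z) ≡ (w + y) + (x + z)
  lemma = solve-∀

∑-* : ∀ n k f → ∑ n (λ i → k * f i) ≡ k * ∑ n f
∑-* zero    k f = sym (*-zeroʳ k)
∑-* (suc n) k f = trans (cong (_+ k * f n) (∑-* n k f)) (sym (*-distribˡ-+ k (∑ n f) (f n)))

∑-const : ∀ n k → ∑ n (λ _ → k) ≡ n * k
∑-const zero    k = refl
∑-const (suc n) k = trans (cong (_+ k) (∑-const n k)) (+-comm (n * k) k)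

∑-split : ∀ m n f → ∑ (m + n) f ≡ ∑ m f + ∑ n (λ i → f (m + i))
∑-split m zero    f = trans (cong (λ k → ∑ k f) (+-identityʳ m)) (sym (+-identityʳ _))
∑-split m (suc n) f = begin
  ∑ (m + suc n) f                                  ≡⟨ cong (λ k → ∑ k f) (+-suc m n) ⟩
  ∑ (m + n) f + f (m + n)                          ≡⟨ cong (_+ f (m + n)) (∑-split m n f) ⟩
  ∑ m f + ∑ n (λ i → f (m + i)) + f (m + n)        ≡⟨ +-assoc (∑ m f) _ _ ⟩
  ∑ m f + (∑ n (λ i → f (m + i)) + f (m + n))      ∎
  where open ≡-Reasoning

∑-id : ∀ n → 2 * ∑ n (λ i → i) + n ≡ n * n
∑-id zero    = refl
∑-id (suc n) = begin
  2 * (∑ n (λ i → i) + n) + (1 + n)          ≡⟨ lemma₁ (∑ n (λ i → i)) n ⟩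
  (2 * ∑ n (λ i → i) + n) + (2 * n + 1)      ≡⟨ cong (_+ (2 * n + 1)) (∑-id n) ⟩
  n * n + (2 * n + 1)                        ≡⟨ lemma₂ n ⟩
  (1 + n) * (1 + n)                          ∎
  where
  open ≡-Reasoning
  lemma₁ : ∀ s n → 2 * (s + n) + (1 + n) ≡ (2 * s + n) + (2 * n + 1)
  lemma₁ = solve-∀
  lemma₂ : ∀ n → n * n + (2 * n + 1) ≡ (1 + n) * (1 + n)
  lemma₂ = solve-∀

-- The index is written digit first, as `j + i * k`, the form to which `L-digit` applies.
∑-blocks : ∀ n k f → ∑ (n * k) f ≡ ∑ n (λ i → ∑ k (λ j → f (j + i * k)))
∑-blocks zero    k f = refl
∑-blocks (suc n) k f = begin
  ∑ (k + n * k) f                                    ≡⟨ cong (λ m → ∑ m f) (+-comm k (n * k)) ⟩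
  ∑ (n * k + k) f                                    ≡⟨ ∑-split (n * k) k f ⟩
  ∑ (n * k) f + ∑ k (λ j → f (n * k + j))            ≡⟨ cong₂ _+_ (∑-blocks n k f) (∑-cong k (λ j _ → cong f (+-comm (n * k) j))) ⟩
  ∑ n (λ i → ∑ k (λ j → f (j + i * k))) + ∑ k (λ j → f (j + n * k)) ∎
  where open ≡-Reasoning

-- Lists arranged in rows of varying length.

module _ (len : ℕ → ℕ) (entry : ℕ → ℕ → ℕ) where

  rows : ℕ → List ℕ
  rows zero    = []
  rows (suc t) = rows t ++ applyUpTo (entry t) (len t)

  length-rows : ∀ t → length (rows t) ≡ ∑ t len
  length-rows zero    = refl
  length-rows (suc t) = trans (length-++ (rows t)) (cong₂ _+_ (length-rows t) (length-applyUpTo (entry t) (len t)))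

  ∈-rows⁺ : ∀ {T t j} → t < T → j < len t → entry t j ∈ₗ rows T
  ∈-rows⁺ {suc T} {t} t<T j< with m≤n⇒m<n∨m≡n (s≤s⁻¹ t<T)
  ... | inj₁ t<T′ = ∈-++⁺ˡ (∈-rows⁺ t<T′ j<)
  ... | inj₂ refl = ∈-++⁺ʳ (rows T) (∈-applyUpTo⁺ (entry T) j<)

  ∈-rows⁻ : ∀ T {x} → x ∈ₗ rows T → ∃[ t ] ∃[ j ] t < T × j < len t × x ≡ entry t j
  ∈-rows⁻ (suc T) x∈ with ∈-++⁻ (rows T) x∈
  ... | inj₁ x∈ˡ = let t , j , t<T , rest = ∈-rows⁻ T x∈ˡ in t , j , m<n⇒m<1+n t<T , rest
  ... | inj₂ x∈ʳ = let j , j< , eq = ∈-applyUpTo⁻ (entry T) x∈ʳ in T , j , ≤-refl , j< , eq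

  -- Injectivity is asked only at positions inside the rows, because the entries used later come
  -- from a truncated subtraction.
  rows-unique : (∀ {t t′ j j′} → j < len t → j′ < len t′ → entry t j ≡ entry t′ j′ → t ≡ t′ × j ≡ j′) →
                ∀ T → Unique (rows T)
  rows-unique inj zero    = []
  rows-unique inj (suc T) = ++⁺ (rows-unique inj T)
    (applyUpTo⁺₁ (entry T) (len T) λ i<j j< eq → <⇒≢ i<j (proj₂ (inj (<-trans i<j j<) j< eq)))
    λ (x∈ˡ , x∈ʳ) → let t , j , t<T , j< , eq = ∈-rows⁻ T x∈ˡ ; j′ , j′< , eq′ = ∈-applyUpTo⁻ (entry T) x∈ʳ in
      <⇒≢ t<T (proj₁ (inj j< j′< (trans (sym eq) eq′)))

[d+m*n]/n≡m : ∀ {d} m n .{{_ : NonZero n}} → d < n → (d + m * n) / n ≡ m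
[d+m*n]/n≡m {d} m n d<n = begin
  (d + m * n) / n        ≡⟨ +-distrib-/-∣ʳ d (n∣m*n m) ⟩
  d / n + m * n / n      ≡⟨ cong₂ _+_ (m<n⇒m/n≡0 d<n) (m*n/n≡m m n) ⟩
  m                      ∎
  where open ≡-Reasoning

-- The function `L` of Legendre's formula and its partial sums.

module LegendreSum (a : ℕ) .{{_ : NonZero a}} where

  private
    b : ℕ
    b = suc a

    1<b : 1 < b
    1<b = s<s (>-nonZero⁻¹ a)

  quotientSum : ℕ → ℕ → ℕ
  quotientSum zero    m = 0
  quotientSum (suc k) m = m / b + quotientSum k (m / b)

  -- L m = ⌊m/b⌋ + ⌊m/b²⌋ + ⋯; fuel m suffices because m < b ^ m.
  L : ℕ → ℕ
  L m = quotientSum m m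

  quotientSum-0 : ∀ k → quotientSum k 0 ≡ 0
  quotientSum-0 zero    = refl
  quotientSum-0 (suc k) = quotientSum-0 k

  m/b≤m∸1 : ∀ m → suc m / b ≤ m
  m/b≤m∸1 m = s≤s⁻¹ (m/n<m (suc m) b 1<b)

  -- Division by `b` lowers a positive argument, so fuel `m` or more lets the argument reach 0,
  -- after which all terms vanish.
  quotientSum-stable : ∀ {k l m} → m ≤ k → m ≤ l → quotientSum k m ≡ quotientSum l m
  quotientSum-stable {k} {l} {zero} _ _ = trans (quotientSum-0 k) (sym (quotientSum-0 l))
  quotientSum-stable {suc k} {suc l} {suc m} (s≤s m≤k) (s≤s m≤l) =
    cong (suc m / b +_) (quotientSum-stable (≤-trans (m/b≤m∸1 m) m≤k) (≤-trans (m/b≤m∸1 m) m≤l))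

  L-unfold : ∀ m → L m ≡ m / b + L (m / b)
  L-unfold zero    = refl
  L-unfold (suc m) = cong (suc m / b +_) (quotientSum-stable (m/b≤m∸1 m) ≤-refl)

  -- Division by `b` deletes the last digit `d`: the first term is `m` and the later ones are those
  -- of `L m`.
  L-digit : ∀ {d} m → d < b → L (d + m * b) ≡ m + L m
  L-digit {d} m d<b = trans (L-unfold (d + m * b)) (cong (λ k → k + L k) ([d+m*n]/n≡m m b d<b))

  L-small : ∀ {d} → d < b → L d ≡ 0
  L-small {d} d<b = trans (cong L (sym (+-identityʳ d))) (L-digit 0 d<b)

  -- Induction on the base-`b` expansion, one last digit at a time.
  digit-induction : (P : ℕ → Set) → P 0 → (∀ {d} m → d < b → P m → P (d + m * b)) → ∀ m → P m
  digit-induction P P0 step = <-rec P λ where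
    zero    rec → P0
    (suc m) rec → subst P (sym (m≡m%n+[m/n]*n (suc m) b))
                    (step (suc m / b) (m%n<n (suc m) b) (rec (m/n<m (suc m) b 1<b)))

  quotientSum-mono : ∀ k {x y} → x ≤ y → quotientSum k x ≤ quotientSum k y
  quotientSum-mono zero    x≤y = z≤n
  quotientSum-mono (suc k) x≤y = +-mono-≤ (/-monoˡ-≤ b x≤y) (quotientSum-mono k (/-monoˡ-≤ b x≤y))

  /-superadditive : ∀ x y → x / b + y / b ≤ (x + y) / b
  /-superadditive x y = begin
    x / b + y / b                        ≡⟨ m*n/n≡m (x / b + y / b) b ⟨
    (x / b + y / b) * b / b              ≡⟨ cong (_/ b) (*-distribʳ-+ b (x / b) (y / b)) ⟩
    (x / b * b + y / b * b) / b          ≤⟨ /-monoˡ-≤ b (+-mono-≤ (m/n*n≤m x b) (m/n*n≤m y b)) ⟩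
    (x + y) / b                          ∎
    where open ≤-Reasoning

  quotientSum-superadditive : ∀ k x y → quotientSum k x + quotientSum k y ≤ quotientSum k (x + y)
  quotientSum-superadditive zero    x y = z≤n
  quotientSum-superadditive (suc k) x y = begin
    (x / b + quotientSum k (x / b)) + (y / b + quotientSum k (y / b))  ≡⟨ lemma (x / b) (quotientSum k (x / b)) (y / b) _ ⟩
    (x / b + y / b) + (quotientSum k (x / b) + quotientSum k (y / b))  ≤⟨ +-monoʳ-≤ _ (quotientSum-superadditive k (x / b) (y / b)) ⟩
    (x / b + y / b) + quotientSum k (x / b + y / b)                    ≤⟨ +-mono-≤ (/-superadditive x y) (quotientSum-mono k (/-superadditive x y)) ⟩
    (x + y) / b + quotientSum k ((x + y) / b)                          ∎
    where
    open ≤-Reasoning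
    lemma : ∀ w x y z → (w + x) + (y + z) ≡ (w + y) + (x + z)
    lemma = solve-∀

  -- Floors are superadditive term by term, once both fuels are raised to `x + y`. This is what
  -- makes the condition `c ≤ L m` survive addition in the semigroup.
  L-superadditive : ∀ x y → L x + L y ≤ L (x + y)
  L-superadditive x y = begin
    L x + L y                                        ≡⟨ cong₂ _+_ (quotientSum-stable ≤-refl (m≤m+n x y)) (quotientSum-stable ≤-refl (m≤n+m y x)) ⟩
    quotientSum (x + y) x + quotientSum (x + y) y    ≤⟨ quotientSum-superadditive (x + y) x y ⟩
    L (x + y)                                        ∎
    where open ≤-Reasoning

  L-mono : ∀ {x y} → x ≤ y → L x ≤ L y
  L-mono {x} {y} x≤y = begin
    L x                  ≤⟨ m≤m+n (L x) (L (y ∸ x)) ⟩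
    L x + L (y ∸ x)      ≤⟨ L-superadditive x (y ∸ x) ⟩
    L (x + (y ∸ x))      ≡⟨ cong L (m+[n∸m]≡n x≤y) ⟩
    L y                  ∎
    where open ≤-Reasoning

  -- Appending a digit `d` raises the difference between the number and `a` times its `L` by exactly
  -- `d`, so the difference never becomes negative.
  a*L≤ : ∀ m → a * L m ≤ m
  a*L≤ = digit-induction (λ m → a * L m ≤ m) (≤-reflexive (*-zeroʳ a)) λ {d} m d<b ih → begin
    a * L (d + m * b)      ≡⟨ cong (a *_) (L-digit m d<b) ⟩
    a * (m + L m)          ≡⟨ *-distribˡ-+ a m (L m) ⟩
    a * m + a * L m        ≤⟨ +-monoʳ-≤ (a * m) ih ⟩
    a * m + m              ≡⟨ lemma a m ⟩
    m * b                  ≤⟨ m≤n+m (m * b) d ⟩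
    d + m * b              ∎
    where
    open ≤-Reasoning
    lemma : ∀ a m → a * m + m ≡ m * (1 + a)
    lemma = solve-∀

  -- m − a * L m is the digit sum of m, at most a per digit.
  ≤a*L+a*k : ∀ k m → m < b ^ k → m ≤ a * L m + a * k
  ≤a*L+a*k zero    zero m<1 = z≤n
  ≤a*L+a*k zero    (suc m) (s≤s ())
  ≤a*L+a*k (suc k) m m<b^k = begin
    m                                              ≡⟨ m≡m%n+[m/n]*n m b ⟩
    m % b + m / b * b                              ≤⟨ +-monoˡ-≤ (m / b * b) (s≤s⁻¹ (m%n<n m b)) ⟩
    a + m / b * b                                  ≡⟨ lemma₁ a (m / b) ⟩
    m / b + (a + a * (m / b))                      ≤⟨ +-monoˡ-≤ (a + a * (m / b)) (≤a*L+a*k k (m / b) (m<n*o⇒m/o<n (subst (m <_) (*-comm b (b ^ k)) m<b^k))) ⟩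
    (a * L (m / b) + a * k) + (a + a * (m / b))    ≡⟨ lemma₂ a (m / b) (L (m / b)) k ⟩
    a * (m / b + L (m / b)) + a * (1 + k)          ≡⟨ cong (λ l → a * l + a * (1 + k)) (L-unfold m) ⟨
    a * L m + a * (1 + k)                          ∎
    where
    open ≤-Reasoning
    lemma₁ : ∀ a m → a + m * (1 + a) ≡ m + (a + a * m)
    lemma₁ = solve-∀
    lemma₂ : ∀ a m l k → (a * l + a * k) + (a + a * m) ≡ a * (m + l) + a * (1 + k)
    lemma₂ = solve-∀

  -- Legendre's formula for a number whose digit sum is `c`.
  L-monomial : ∀ {c} k → c < b → a * L (c * b ^ k) + c ≡ c * b ^ k
  L-monomial {c} zero c<b = begin
    a * L (c * 1) + c    ≡⟨ cong (λ m → a * L m + c) (*-identityʳ c) ⟩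
    a * L c + c          ≡⟨ cong (λ l → a * l + c) (L-small c<b) ⟩
    a * 0 + c            ≡⟨ cong (_+ c) (*-zeroʳ a) ⟩
    c                    ≡⟨ *-identityʳ c ⟨
    c * 1                ∎
    where open ≡-Reasoning
  L-monomial {c} (suc k) c<b = begin
    a * L (c * (b * b ^ k)) + c                ≡⟨ cong (λ m → a * L m + c) (lemma₁ b c (b ^ k)) ⟩
    a * L (c * b ^ k * b) + c                  ≡⟨ cong (λ l → a * l + c) (L-digit (c * b ^ k) z<s) ⟩
    a * (c * b ^ k + L (c * b ^ k)) + c        ≡⟨ lemma₂ a c (b ^ k) (L (c * b ^ k)) ⟩
    a * (c * b ^ k) + (a * L (c * b ^ k) + c)  ≡⟨ cong (a * (c * b ^ k) +_) (L-monomial k c<b) ⟩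
    a * (c * b ^ k) + c * b ^ k                ≡⟨ lemma₃ a c (b ^ k) ⟩
    c * (b * b ^ k)                            ∎
    where
    open ≡-Reasoning
    lemma₁ : ∀ b c p → c * (b * p) ≡ c * p * b
    lemma₁ = solve-∀
    lemma₂ : ∀ a c p l → a * (c * p + l) + c ≡ a * (c * p) + (a * l + c)
    lemma₂ = solve-∀
    lemma₃ : ∀ a c p → a * (c * p) + c * p ≡ c * ((1 + a) * p)
    lemma₃ = solve-∀

  L-power : ∀ k → a * L (b ^ k) + 1 ≡ b ^ k
  L-power k = subst (λ m → a * L m + 1 ≡ m) (*-identityˡ (b ^ k)) (L-monomial k 1<b)

  -- The case `c = a` of `L-monomial`, divided by `a`.
  L-a*power : ∀ k → L (a * b ^ k) + 1 ≡ b ^ k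
  L-a*power k = *-cancelˡ-≡ _ _ a (trans (lemma a (L (a * b ^ k))) (L-monomial k (n<1+n a)))
    where
    lemma : ∀ a l → a * (l + 1) ≡ a * l + a
    lemma = solve-∀

  ∑L : ℕ → ℕ
  ∑L n = ∑ n L

  -- Numbers that agree except in the last digit form blocks of size `b`, and `L` is constantly
  -- `i + L i` on block `i`. Doubling and the summand `b * n` avoid the division and subtraction in
  -- the sum of the `i < n`.
  ∑L-*b : ∀ n → 2 * ∑L (n * b) + b * n ≡ b * (n * n + 2 * ∑L n)
  ∑L-*b n = begin
    2 * ∑L (n * b) + b * n                                      ≡⟨ cong (λ s → 2 * s + b * n) sum ⟩
    2 * (b * (∑ n (λ i → i) + ∑L n)) + b * n                    ≡⟨ lemma b (∑ n (λ i → i)) (∑L n) n ⟩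
    b * ((2 * ∑ n (λ i → i) + n) + 2 * ∑L n)                    ≡⟨ cong (λ s → b * (s + 2 * ∑L n)) (∑-id n) ⟩
    b * (n * n + 2 * ∑L n)                                      ∎
    where
    open ≡-Reasoning
    lemma : ∀ b s t n → 2 * (b * (s + t)) + b * n ≡ b * ((2 * s + n) + 2 * t)
    lemma = solve-∀
    sum : ∑L (n * b) ≡ b * (∑ n (λ i → i) + ∑L n)
    sum = begin
      ∑L (n * b)                                    ≡⟨ ∑-blocks n b L ⟩
      ∑ n (λ i → ∑ b (λ j → L (j + i * b)))         ≡⟨ ∑-cong n (λ i _ → ∑-cong b (λ j j<b → L-digit i j<b)) ⟩
      ∑ n (λ i → ∑ b (λ j → i + L i))               ≡⟨ ∑-cong n (λ i _ → ∑-const b (i + L i)) ⟩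
      ∑ n (λ i → b * (i + L i))                     ≡⟨ ∑-* n b (λ i → i + L i) ⟩
      b * ∑ n (λ i → i + L i)                       ≡⟨ cong (b *_) (∑-+ n (λ i → i) L) ⟩
      b * (∑ n (λ i → i) + ∑L n)                    ∎

  ∑L-small : ∑L a ≡ 0
  ∑L-small = trans (∑-cong a (λ i i<a → L-small (m<n⇒m<1+n i<a))) (trans (∑-const a 0) (*-zeroʳ a))

  ∑L-a*power : ∀ k → 2 * ∑L (a * b ^ k) + a * b ^ k * (1 + k) ≡ a * (b ^ k * b ^ k)
  ∑L-a*power zero = begin
    2 * ∑L (a * 1) + a * 1 * 1     ≡⟨ cong (λ m → 2 * ∑L m + a * 1 * 1) (*-identityʳ a) ⟩
    2 * ∑L a + a * 1 * 1           ≡⟨ cong (λ s → 2 * s + a * 1 * 1) ∑L-small ⟩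
    a * 1 * 1                      ≡⟨ *-identityʳ (a * 1) ⟩
    a * 1                          ∎
    where open ≡-Reasoning
  -- The range grows by the factor `b`; the summand cancelled here completes the left side of
  -- `∑L-*b` for `N`.
  ∑L-a*power (suc k) = +-cancelʳ-≡ (b * (a * b ^ k)) _ _ (begin
    2 * ∑L (a * (b * p)) + a * (b * p) * (2 + k) + b * (a * p)     ≡⟨ cong (λ m → 2 * ∑L m + a * (b * p) * (2 + k) + b * (a * p)) (lemma₁ b a p) ⟩
    2 * ∑L (N * b) + a * (b * p) * (2 + k) + b * (a * p)           ≡⟨ lemma₂ b a p k (∑L (N * b)) ⟩
    (2 * ∑L (N * b) + b * N) + a * (b * p) * (2 + k)               ≡⟨ cong (_+ a * (b * p) * (2 + k)) (∑L-*b N) ⟩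
    b * (N * N + 2 * ∑L N) + a * (b * p) * (2 + k)                 ≡⟨ lemma₃ b a p k (∑L N) ⟩
    b * (2 * ∑L N + N * (1 + k)) + b * (N * N) + b * N             ≡⟨ cong (λ s → b * s + b * (N * N) + b * N) (∑L-a*power k) ⟩
    b * (a * (p * p)) + b * (N * N) + b * N                        ≡⟨ lemma₄ a p ⟩
    a * ((b * p) * (b * p)) + b * (a * p)                          ∎)
    where
    open ≡-Reasoning
    p = b ^ k
    N = a * p
    lemma₁ : ∀ b a p → a * (b * p) ≡ a * p * b
    lemma₁ = solve-∀
    lemma₂ : ∀ b a p k s → 2 * s + a * (b * p) * (2 + k) + b * (a * p) ≡ (2 * s + b * (a * p)) + a * (b * p) * (2 + k)
    lemma₂ = solve-∀
    lemma₃ : ∀ b a p k s → b * (a * p * (a * p) + 2 * s) + a * (b * p) * (2 + k) ≡ b * (2 * s + a * p * (1 + k)) + b * (a * p * (a * p)) + b * (a * p)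
    lemma₃ = solve-∀
    lemma₄ : ∀ a p → (1 + a) * (a * (p * p)) + (1 + a) * (a * p * (a * p)) + (1 + a) * (a * p) ≡ a * (((1 + a) * p) * ((1 + a) * p)) + (1 + a) * (a * p)
    lemma₄ = solve-∀

m≤n⇒∃+ : ∀ {m n} → m ≤ n → ∃[ k ] m + k ≡ n
m≤n⇒∃+ {m} {n} m≤n = n ∸ m , m+[n∸m]≡n m≤n

n<b^n : ∀ {b} n → 2 ≤ b → n < b ^ n
n<b^n zero 2≤b = ≤-refl
n<b^n {b} (suc n) 2≤b = begin-strict
  suc n               <⟨ s<s (m<m+n n z<s) ⟩
  suc n + suc n       ≤⟨ +-mono-≤ (n<b^n n 2≤b) (n<b^n n 2≤b) ⟩
  b ^ n + b ^ n       ≡⟨ cong (b ^ n +_) (+-identityʳ (b ^ n)) ⟨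
  2 * b ^ n           ≤⟨ *-monoˡ-≤ (b ^ n) 2≤b ⟩
  b * b ^ n           ∎
  where open ≤-Reasoning

-- Sums of powers of `b` and membership in the semigroup.

module Powers (a : ℕ) .{{_ : NonZero a}} (n : ℕ) where

  open LegendreSum a

  private
    b q : ℕ
    b = suc a
    q = b ^ n

  -- A sum of `k` generators `b ^ (n + i) + 1` is `k + q * m`, where `m` is the sum of the `k`
  -- powers `b ^ i`; hence the two indices.
  data PowerSum : ℕ → ℕ → Set where
    []  : PowerSum 0 0
    _∷_ : ∀ i {k m} → PowerSum k m → PowerSum (suc k) (b ^ i + m)

  ones : ∀ d {k m} → PowerSum k m → PowerSum (d + k) (d + m)
  ones zero    s = s
  ones (suc d) s = 0 ∷ ones d s

  shift : ∀ {k m} → PowerSum k m → PowerSum k (m * b)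
  shift []                = []
  shift (_∷_ i {k} {m} s) = subst (PowerSum (suc k)) (lemma b (b ^ i) m) (suc i ∷ shift s)
    where
    lemma : ∀ b p m → b * p + m * b ≡ (p + m) * b
    lemma = solve-∀

  replicate-b : ∀ c → PowerSum c (c * b)
  replicate-b c = shift (subst₂ PowerSum (+-identityʳ c) (+-identityʳ c) (ones c []))

  -- Merging `b` equal powers into the next one lowers the number of summands by `a`; `c` counts
  -- such merges, starting from `m` ones. The digit induction chooses them explicitly.
  powerSum : ∀ m {c k} → c ≤ L m → k + a * c ≡ m → PowerSum k m
  powerSum = digit-induction (λ m → ∀ {c k} → c ≤ L m → k + a * c ≡ m → PowerSum k m) base step
    where
    base : ∀ {c k} → c ≤ 0 → k + a * c ≡ 0 → PowerSum k 0
    base {k = k} _ eq = subst (λ k → PowerSum k 0) (sym (m+n≡0⇒m≡0 k eq)) []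

    lemma₁ : ∀ a d c e → d + (c + e) * (1 + a) ≡ (d + e * (1 + a) + c) + a * c
    lemma₁ = solve-∀
    lemma₂ : ∀ b d c e → d + e * b + c * b ≡ d + (c + e) * b
    lemma₂ = solve-∀
    lemma₃ : ∀ a d m c k → d + (m + (k + a * c)) + a * m ≡ d + k + a * (m + c) + m
    lemma₃ = solve-∀
    lemma₄ : ∀ a d m → d + m * (1 + a) + m ≡ d + (m + m) + a * m
    lemma₄ = solve-∀

    step : ∀ {d} m → d < b → (∀ {c k} → c ≤ L m → k + a * c ≡ m → PowerSum k m) →
           ∀ {c k} → c ≤ L (d + m * b) → k + a * c ≡ d + m * b → PowerSum k (d + m * b)
    step {d} m d<b ih {c} {k} c≤ eq with ≤-total c m
    -- Few merges: take `c` copies of `b` and fill up with ones.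
    ... | inj₁ c≤m with e , refl ← m≤n⇒∃+ c≤m =
      subst₂ PowerSum (+-cancelʳ-≡ (a * c) _ _ (trans (sym (lemma₁ a d c e)) (sym eq))) (lemma₂ b d c e)
        (ones (d + e * b) (replicate-b c))
    -- Many merges: use `m` of them to turn all of `m * b` into copies of `b`, and the other `c′`
    -- inside `m`, whose representation is then multiplied by `b`.
    ... | inj₂ m≤c with c′ , refl ← m≤n⇒∃+ m≤c =
      subst (λ k → PowerSum k (d + m * b)) d+k′≡k (ones d (shift (ih c′≤L k′+ac′≡m)))
      where
      c′≤L : c′ ≤ L m
      c′≤L = +-cancelˡ-≤ m c′ (L m) (subst (m + c′ ≤_) (L-digit m d<b) c≤)
      k′ = m ∸ a * c′
      k′+ac′≡m : k′ + a * c′ ≡ m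
      k′+ac′≡m = m∸n+n≡m (≤-trans (*-monoʳ-≤ a c′≤L) (a*L≤ m))
      d+k′≡k : d + k′ ≡ k
      d+k′≡k = +-cancelʳ-≡ (a * (m + c′)) _ _ (+-cancelʳ-≡ m _ _ (begin
        d + k′ + a * (m + c′) + m          ≡⟨ lemma₃ a d m c′ k′ ⟨
        d + (m + (k′ + a * c′)) + a * m    ≡⟨ cong (λ x → d + (m + x) + a * m) k′+ac′≡m ⟩
        d + (m + m) + a * m                ≡⟨ lemma₄ a d m ⟨
        d + m * b + m                      ≡⟨ cong (_+ m) eq ⟨
        k + a * (m + c′) + m               ∎))
        where open ≡-Reasoning

  PowerSum⇒∈ : ∀ {k m} → PowerSum k m → k + q * m ∈ SC⁺ b n
  PowerSum⇒∈ [] = subst (_∈ SC⁺ b n) (sym (*-zeroʳ q)) zero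
  PowerSum⇒∈ (_∷_ i {k} {m} s) = subst (_∈ SC⁺ b n) eq (add (gen (i , refl)) (PowerSum⇒∈ s))
    where
    lemma : ∀ q p k m → q * p + 1 + (k + q * m) ≡ 1 + k + q * (p + m)
    lemma = solve-∀
    eq : b ^ (n + i) + 1 + (k + q * m) ≡ suc k + q * (b ^ i + m)
    eq = trans (cong (λ p → p + 1 + (k + q * m)) (^-distribˡ-+-* b n i)) (lemma q (b ^ i) k m)

  -- With `k = t ∸ a * c`, not truncated by `a*L≤`, the equation reads `x = k + q * t`, and
  -- `powerSum` writes `t` with `k` powers.
  ∈SC⁺⁺ : ∀ {x} t c → x + a * c ≡ suc q * t → c ≤ L t → x ∈ SC⁺ b n
  ∈SC⁺⁺ {x} t c eq c≤ = subst (_∈ SC⁺ b n) k+qt≡x (PowerSum⇒∈ (powerSum t c≤ k+ac≡t))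
    where
    k = t ∸ a * c
    k+ac≡t : k + a * c ≡ t
    k+ac≡t = m∸n+n≡m (≤-trans (*-monoʳ-≤ a c≤) (a*L≤ t))
    lemma : ∀ k y z → k + y + z ≡ k + z + y
    lemma = solve-∀
    k+qt≡x : k + q * t ≡ x
    k+qt≡x = +-cancelʳ-≡ (a * c) _ _
      (trans (lemma k (q * t) (a * c)) (trans (cong (_+ q * t) k+ac≡t) (sym eq)))

  -- A generator has `m = b ^ i` and `c = L m`, since `b ^ i` has digit sum 1; superadditivity of
  -- `L` preserves the bound under sums.
  ∈SC⁺⁻ : ∀ {x} → x ∈ SC⁺ b n → ∃[ m ] ∃[ c ] x + a * c ≡ suc q * m × c ≤ L m
  ∈SC⁺⁻ (gen (i , refl)) = b ^ i , L (b ^ i) , eq , ≤-refl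
    where
    lemma : ∀ x y → x + 1 + y ≡ y + 1 + x
    lemma = solve-∀
    eq : b ^ (n + i) + 1 + a * L (b ^ i) ≡ suc q * b ^ i
    eq = trans (lemma (b ^ (n + i)) (a * L (b ^ i))) (cong₂ _+_ (L-power i) (^-distribˡ-+-* b n i))
  ∈SC⁺⁻ zero = 0 , 0 , trans (*-zeroʳ a) (sym (*-zeroʳ q)) , z≤n
  ∈SC⁺⁻ (add {x} {y} x∈ y∈) =
    let m , c , eq , c≤ = ∈SC⁺⁻ x∈
        m′ , c′ , eq′ , c′≤ = ∈SC⁺⁻ y∈
    in m + m′ , c + c′ ,
       trans (lemma a x c y c′) (trans (cong₂ _+_ eq eq′) (sym (*-distribˡ-+ (suc q) m m′))) ,
       ≤-trans (+-mono-≤ c≤ c′≤) (L-superadditive m m′)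
    where
    lemma : ∀ a x c y c′ → x + y + a * (c + c′) ≡ x + a * c + (y + a * c′)
    lemma = solve-∀

  private
    q≤L[bq] : q ≤ L (b ^ suc n)
    q≤L[bq] = begin
      q                  ≤⟨ m≤m+n q (L q) ⟩
      q + L q            ≡⟨ L-digit q z<s ⟨
      L (q * b)          ≡⟨ cong L (*-comm q b) ⟩
      L (b * q)          ∎
      where open ≤-Reasoning

  -- Among the representations x = (q + 1)t − ac of a fixed x, the one with
  -- c ≤ q is the most favourable for c ≤ L t.
  L-reduce : ∀ {c} t l → c ≤ q → c + l * suc q ≤ L (t + a * l) → c ≤ L t
  L-reduce {c} t zero c≤q h = subst₂ _≤_ (+-identityʳ c) (cong L (trans (cong (t +_) (*-zeroʳ a)) (+-identityʳ t))) h
  L-reduce {c} t l@(suc l′) c≤q h with t <? b ^ suc n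
  -- For `t` at least `b ^ suc n`, already `L t` is at least `q`.
  ... | no  t≮ = ≤-trans c≤q (≤-trans q≤L[bq] (L-mono (≮⇒≥ t≮)))
  -- Otherwise `t` has at most `suc n` digits, so `c + l * q` is at most `L t + suc n`, hence at
  -- most `L t + q`. Since `l` is positive, one `q` can be cancelled.
  ... | yes t< = +-cancelʳ-≤ q c (L t) (begin
    c + q                ≤⟨ +-monoʳ-≤ c (m≤m+n q (l′ * q)) ⟩
    c + l * q            ≤⟨ *-cancelˡ-≤ a (begin
      a * (c + l * q)          ≤⟨ +-cancelʳ-≤ (a * l) _ _ (begin
        a * (c + l * q) + a * l    ≡⟨ lemma a c l q ⟨
        a * (c + l * (1 + q))      ≤⟨ *-monoʳ-≤ a h ⟩
        a * L (t + a * l)          ≤⟨ a*L≤ (t + a * l) ⟩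
        t + a * l                  ∎) ⟩
      t                        ≤⟨ ≤a*L+a*k (suc n) t t< ⟩
      a * L t + a * suc n      ≡⟨ *-distribˡ-+ a (L t) (suc n) ⟨
      a * (L t + suc n)        ∎) ⟩
    L t + suc n          ≤⟨ +-monoʳ-≤ (L t) (n<b^n n (s<s (>-nonZero⁻¹ a))) ⟩
    L t + q              ∎)
    where
    open ≤-Reasoning
    lemma : ∀ a c l q → a * (c + l * (1 + q)) ≡ a * (c + l * q) + a * l
    lemma = solve-∀

-- `L` and its partial sum at the threshold `a * b ^ n + b`.

module Threshold (a : ℕ) .{{_ : NonZero a}} (k : ℕ) where

  open LegendreSum a

  private
    -- Here `n = 2 + k`, so `b * p` is `b ^ n` and the threshold is `N * b`.
    b p N : ℕ
    b = suc a
    p = b ^ suc k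
    N = suc (a * p)

    -- As `p` is a multiple of `b`, the numbers `N` and `a * p` differ only in the last digit, which
    -- `L` ignores. This is where `n ≥ 2` enters.
    L[N]+1≡p : L N + 1 ≡ p
    L[N]+1≡p = begin
      L (1 + a * (b * b ^ k)) + 1          ≡⟨ cong (λ m → L (1 + m) + 1) (lemma a b (b ^ k)) ⟩
      L (1 + a * b ^ k * b) + 1            ≡⟨ cong (_+ 1) (L-digit (a * b ^ k) (s<s (>-nonZero⁻¹ a))) ⟩
      a * b ^ k + L (a * b ^ k) + 1        ≡⟨ cong (_+ 1) (L-digit (a * b ^ k) z<s) ⟨
      L (a * b ^ k * b) + 1                ≡⟨ cong (λ m → L m + 1) (lemma a b (b ^ k)) ⟨
      L (a * b ^ suc k) + 1                ≡⟨ L-a*power (suc k) ⟩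
      b ^ suc k                            ∎
      where
      open ≡-Reasoning
      lemma : ∀ a b p → a * (b * p) ≡ a * p * b
      lemma = solve-∀

    T≡N*b : a * (b * p) + b ≡ N * b
    T≡N*b = lemma a b p
      where
      lemma : ∀ a b p → a * (b * p) + b ≡ (1 + a * p) * b
      lemma = solve-∀

  L-threshold : L (a * (b * p) + b) ≡ b * p
  L-threshold = begin
    L (a * (b * p) + b)        ≡⟨ cong L T≡N*b ⟩
    L (N * b)                  ≡⟨ L-digit N z<s ⟩
    N + L N                    ≡⟨ lemma₁ (a * p) (L N) ⟩
    a * p + (L N + 1)          ≡⟨ cong (a * p +_) L[N]+1≡p ⟩
    a * p + p                  ≡⟨ +-comm (a * p) p ⟩
    b * p                      ∎
    where
    open ≡-Reasoning
    lemma₁ : ∀ y l → 1 + y + l ≡ y + (l + 1)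
    lemma₁ = solve-∀

  -- `∑L-*b` reduces the range to `N = 1 + a * p`; its last term is given by `L-a*power` and the
  -- rest by `∑L-a*power`.
  ∑L-threshold : 2 * ∑L (a * (b * p) + b) + a * (b * p) * (2 + k) + 2 * b ≡ a * (b * p) * suc (b * p) + 2 * (b * p)
  ∑L-threshold = +-cancelʳ-≡ (b * N) _ _ (begin
    2 * ∑L (a * (b * p) + b) + a * (b * p) * n + 2 * b + b * N                  ≡⟨ cong (λ m → 2 * ∑L m + a * (b * p) * n + 2 * b + b * N) T≡N*b ⟩
    2 * ∑L (N * b) + a * (b * p) * n + 2 * b + b * N                            ≡⟨ lemma₁ (2 * ∑L (N * b)) (a * (b * p) * n) (2 * b) (b * N) ⟩
    (2 * ∑L (N * b) + b * N) + a * (b * p) * n + 2 * b                          ≡⟨ cong (λ s → s + a * (b * p) * n + 2 * b) (∑L-*b N) ⟩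
    b * (N * N + 2 * (∑L (a * p) + L (a * p))) + a * (b * p) * n + 2 * b        ≡⟨ lemma₂ a b p n N (∑L (a * p)) (L (a * p)) ⟩
    b * (N * N) + b * (2 * ∑L (a * p) + a * p * n) + 2 * b * (L (a * p) + 1)    ≡⟨ cong₂ (λ s l → b * (N * N) + b * s + 2 * b * l) (∑L-a*power (suc k)) (L-a*power (suc k)) ⟩
    b * (N * N) + b * (a * (p * p)) + 2 * b * p                                 ≡⟨ lemma₃ a p ⟩
    a * (b * p) * suc (b * p) + 2 * (b * p) + b * N                             ∎)
    where
    open ≡-Reasoning
    n = 2 + k
    lemma₁ : ∀ w x y z → w + x + y + z ≡ w + z + x + y
    lemma₁ = solve-∀
    lemma₂ : ∀ a b p n N s l → b * (N * N + 2 * (s + l)) + a * (b * p) * n + 2 * b ≡ b * (N * N) + b * (2 * s + a * p * n) + 2 * b * (l + 1)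
    lemma₂ = solve-∀
    lemma₃ : ∀ a p → (1 + a) * ((1 + a * p) * (1 + a * p)) + (1 + a) * (a * (p * p)) + 2 * (1 + a) * p
                     ≡ a * ((1 + a) * p) * (1 + (1 + a) * p) + 2 * ((1 + a) * p) + (1 + a) * (1 + a * p)
    lemma₃ = solve-∀

module _ (a : ℕ) .{{_ : NonZero a}} where

  open LegendreSum a

  private
    b : ℕ
    b = suc a

  L[aq+b]≡q : ∀ {n} → 2 ≤ n → L (a * b ^ n + b) ≡ b ^ n
  L[aq+b]≡q {suc (suc k)} _ = Threshold.L-threshold a k
  L[aq+b]≡q {1} (s≤s ())

  ∑L[aq+b] : ∀ {n} → 2 ≤ n → 2 * ∑L (a * b ^ n + b) + a * b ^ n * n + 2 * b ≡ a * b ^ n * suc (b ^ n) + 2 * b ^ n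
  ∑L[aq+b] {suc (suc k)} _ = Threshold.∑L-threshold a k
  ∑L[aq+b] {1} (s≤s ())

-- Representations modulo `Q = q + 1` for odd `a`.

module Gaps (a g n : ℕ) .{{_ : NonZero a}} (a≡1+2g : a ≡ 1 + g * 2) (2≤n : 2 ≤ n) where

  b q Q r T : ℕ
  b = suc a
  q = b ^ n
  Q = suc q
  T = a * q + b

  open LegendreSum a
  open Powers a n

  r = L q

  -- The digit sum of `q` is 1, so `q = 1 + a * L q`.
  Q≡2+ra : Q ≡ 2 + r * a
  Q≡2+ra = cong suc (trans (sym (L-power n)) (trans (+-comm (a * r) 1) (cong suc (*-comm a r))))

  L[T]≡q : L T ≡ q
  L[T]≡q = L[aq+b]≡q a 2≤n

  ∑L-T : 2 * ∑L T + a * q * n + 2 * b ≡ a * q * Q + 2 * q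
  ∑L-T = ∑L[aq+b] a 2≤n

  -- A common divisor divides 2 by `Q≡2+ra`, and then 1 because `a` is odd.
  Q-coprime-a : Coprime Q a
  Q-coprime-a {d} (d∣Q , d∣a) = ∣1⇒≡1 (∣m+n∣m⇒∣n (subst (d ∣_) (trans a≡1+2g (+-comm 1 (g * 2))) d∣a) (∣n⇒∣m*n g d∣2))
    where
    d∣2 : d ∣ 2
    d∣2 = ∣m+n∣m⇒∣n (subst (d ∣_) (trans Q≡2+ra (+-comm 2 (r * a))) d∣Q) (∣n⇒∣m*n r d∣a)

  Q∣difference : ∀ {x t m} c e → x + a * c ≡ Q * t → x + a * (c + e) ≡ Q * m → Q ∣ e
  Q∣difference {x} {t} {m} c e eq eq′ = coprime-divisor Q-coprime-a (∣m+n∣m⇒∣n (divides m (begin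
    x + a * c + a * e      ≡⟨ lemma a x c e ⟩
    x + a * (c + e)        ≡⟨ eq′ ⟩
    Q * m                  ≡⟨ *-comm Q m ⟩
    m * Q                  ∎)) (divides t (trans eq (*-comm Q t))))
    where
    open ≡-Reasoning
    lemma : ∀ a x c e → x + a * c + a * e ≡ x + a * (c + e)
    lemma = solve-∀

  -- Both coefficients are congruent modulo `Q`, and `c ≤ q < Q` makes `c` the least residue, so
  -- `c′` exceeds it by a multiple of `Q`.
  reduce : ∀ {x t m} c c′ → c ≤ q → x + a * c ≡ Q * t → x + a * c′ ≡ Q * m →
           ∃[ l ] c′ ≡ c + l * Q × m ≡ t + a * l
  reduce {x} {t} {m} c c′ c≤q eq eq′ with ≤-total c c′
  ... | inj₁ c≤c′ with e , refl ← m≤n⇒∃+ c≤c′ with divides-refl l ← Q∣difference c e eq eq′ =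
    l , refl , *-cancelˡ-≡ m (t + a * l) Q (begin
      Q * m                        ≡⟨ eq′ ⟨
      x + a * (c + l * Q)          ≡⟨ lemma₁ a x c l Q ⟩
      x + a * c + a * l * Q        ≡⟨ cong (_+ a * l * Q) eq ⟩
      Q * t + a * l * Q            ≡⟨ lemma₂ Q t (a * l) ⟩
      Q * (t + a * l)              ∎)
    where
    open ≡-Reasoning
    lemma₁ : ∀ a x c l Q → x + a * (c + l * Q) ≡ x + a * c + a * l * Q
    lemma₁ = solve-∀
    lemma₂ : ∀ Q t y → Q * t + y * Q ≡ Q * (t + y)
    lemma₂ = solve-∀
  ... | inj₂ c′≤c with m≤n⇒∃+ c′≤c
  ...   | zero , refl = 0 , trans (sym (+-identityʳ c′)) (sym (+-identityʳ (c′ + 0))) ,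
          *-cancelˡ-≡ m (t + a * 0) Q (begin
            Q * m                ≡⟨ eq′ ⟨
            x + a * c′           ≡⟨ cong (λ c → x + a * c) (+-identityʳ c′) ⟨
            x + a * (c′ + 0)     ≡⟨ eq ⟩
            Q * t                ≡⟨ cong (Q *_) (+-identityʳ t) ⟨
            Q * (t + 0)          ≡⟨ cong (λ y → Q * (t + y)) (*-zeroʳ a) ⟨
            Q * (t + a * 0)      ∎)
    where open ≡-Reasoning
  ...   | e@(suc _) , refl = contradiction (Q∣difference c′ e eq′ eq) (>⇒∤ (s≤s (≤-trans (m≤n+m e c′) c≤q)))

  representation : ∀ x → ∃[ t ] ∃[ c ] c ≤ q × x + a * c ≡ Q * t
  representation x = quotient Q∣x+ac , c , s≤s⁻¹ (m%n<n y Q) , m∣n⇒n≡m*quotient Q∣x+ac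
    where
    open ≡-Reasoning
    -- u inverts a modulo Q and q ≡ −1, so c ≡ −x/a.
    u = 1 + g * r
    y = q * u * x
    c = y % Q
    au≡1+gQ : a * u ≡ 1 + g * Q
    au≡1+gQ = begin
      a * (1 + g * r)          ≡⟨ lemma₀ a g r ⟩
      a + g * (r * a)          ≡⟨ cong (_+ g * (r * a)) a≡1+2g ⟩
      1 + g * 2 + g * (r * a)  ≡⟨ cong suc (*-distribˡ-+ g 2 (r * a)) ⟨
      1 + g * (2 + r * a)      ≡⟨ cong (λ Q → 1 + g * Q) Q≡2+ra ⟨
      1 + g * Q                ∎
      where
      lemma₀ : ∀ a g r → a * (1 + g * r) ≡ a + g * (r * a)
      lemma₀ = solve-∀
    lemma₁ : ∀ a x c k Q → a * k * Q + (x + a * c) ≡ x + a * (c + k * Q)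
    lemma₁ = solve-∀
    lemma₂ : ∀ a x q u → x + a * (q * u * x) ≡ x + q * x * (a * u)
    lemma₂ = solve-∀
    lemma₃ : ∀ x q g → x + q * x * (1 + g * (1 + q)) ≡ (x + q * x * g) * (1 + q)
    lemma₃ = solve-∀
    Q∣x+ac : Q ∣ x + a * c
    -- Modulo `Q` the residue `c` may be replaced by `y`, and `x + a * y` is then congruent to
    -- `x + q * x = x * Q`.
    Q∣x+ac = ∣m+n∣m⇒∣n (divides (x + q * x * g) (begin
      a * (y / Q) * Q + (x + a * c)      ≡⟨ lemma₁ a x c (y / Q) Q ⟩
      x + a * (c + y / Q * Q)            ≡⟨ cong (λ z → x + a * z) (m≡m%n+[m/n]*n y Q) ⟨
      x + a * (q * u * x)                ≡⟨ lemma₂ a x q u ⟩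
      x + q * x * (a * u)                ≡⟨ cong (λ z → x + q * x * z) au≡1+gQ ⟩
      x + q * x * (1 + g * Q)            ≡⟨ lemma₃ x q g ⟩
      (x + q * x * g) * Q                ∎)) (n∣m*n (a * (y / Q)))

  -- The sum of the floors of `Q * t / a` over `t < a`.

  floor : ℕ → ℕ
  floor t = Q * t / a

  -- Modulo `a` the product `Q * t` leaves `2 * t`, which is below `a` for `t ≤ g`.
  floor-low : ∀ t → t < suc g → floor t ≡ r * t
  floor-low t t≤g = trans (cong (_/ a) (trans (cong (_* t) Q≡2+ra) (lemma a r t)))
                          ([d+m*n]/n≡m (r * t) a (subst (t * 2 <_) (sym a≡1+2g) (s≤s (*-monoˡ-≤ 2 (s≤s⁻¹ t≤g)))))
    where
    lemma : ∀ a r t → (2 + r * a) * t ≡ t * 2 + r * t * a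
    lemma = solve-∀

  -- Now `2 * t` equals `a + 1 + 2 * i`, which gives one carry and the remainder `1 + 2 * i`.
  floor-high : ∀ i → i < g → floor (suc g + i) ≡ r * (suc g + i) + 1
  floor-high i i<g = trans (cong (_/ a) Qt≡)
    ([d+m*n]/n≡m (r * (suc g + i) + 1) a (subst (1 + i * 2 <_) (sym a≡1+2g) (s<s (*-monoˡ-< 2 i<g))))
    where
    open ≡-Reasoning
    lemma₁ : ∀ r a g i → (2 + r * a) * (1 + g + i) ≡ 1 + i * 2 + (r * (1 + g + i) * a + (1 + g * 2))
    lemma₁ = solve-∀
    lemma₂ : ∀ a y → y * a + a ≡ (y + 1) * a
    lemma₂ = solve-∀
    Qt≡ : Q * (suc g + i) ≡ 1 + i * 2 + (r * (suc g + i) + 1) * a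
    Qt≡ = begin
      Q * (suc g + i)                                      ≡⟨ cong (_* (suc g + i)) Q≡2+ra ⟩
      (2 + r * a) * (suc g + i)                            ≡⟨ lemma₁ r a g i ⟩
      1 + i * 2 + (r * (suc g + i) * a + (1 + g * 2))      ≡⟨ cong (λ y → 1 + i * 2 + (r * (suc g + i) * a + y)) a≡1+2g ⟨
      1 + i * 2 + (r * (suc g + i) * a + a)                ≡⟨ cong (1 + i * 2 +_) (lemma₂ a (r * (suc g + i))) ⟩
      1 + i * 2 + (r * (suc g + i) + 1) * a                ∎

  a≡1+g+g : a ≡ suc g + g
  a≡1+g+g = trans a≡1+2g (lemma g)
    where
    lemma : ∀ g → 1 + g * 2 ≡ 1 + g + g
    lemma = solve-∀

  ∑-floor : ∑ a floor ≡ r * ∑ a (λ t → t) + g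
  ∑-floor = begin
    ∑ a floor                                                            ≡⟨ cong (λ m → ∑ m floor) a≡1+g+g ⟩
    ∑ (suc g + g) floor                                                  ≡⟨ ∑-split (suc g) g floor ⟩
    ∑ (suc g) floor + ∑ g (λ i → floor (suc g + i))                      ≡⟨ cong₂ _+_ (∑-cong (suc g) floor-low) (∑-cong g floor-high) ⟩
    ∑ (suc g) (r *_) + ∑ g (λ i → r * (suc g + i) + 1)                   ≡⟨ cong (∑ (suc g) (r *_) +_) (∑-+ g (λ i → r * (suc g + i)) (λ _ → 1)) ⟩
    ∑ (suc g) (r *_) + (∑ g (λ i → r * (suc g + i)) + ∑ g (λ _ → 1))     ≡⟨ +-assoc (∑ (suc g) (r *_)) _ _ ⟨
    ∑ (suc g) (r *_) + ∑ g (λ i → r * (suc g + i)) + ∑ g (λ _ → 1)       ≡⟨ cong₂ _+_ (∑-split (suc g) g (r *_)) (sym (trans (∑-const g 1) (*-identityʳ g))) ⟨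
    ∑ (suc g + g) (r *_) + g                                             ≡⟨ cong (λ m → ∑ m (r *_) + g) a≡1+g+g ⟨
    ∑ a (r *_) + g                                                       ≡⟨ cong (_+ g) (∑-* a r (λ t → t)) ⟩
    r * ∑ a (λ t → t) + g                                                ∎
    where open ≡-Reasoning

  -- Adding `q = 1 + r * a` completes `2 * g` to `a` and twice the sum of the `t < a` to `a * a`.
  2∑-floor : 2 * ∑ a floor + q ≡ q * a
  2∑-floor = begin
    2 * ∑ a floor + q                                  ≡⟨ cong₂ (λ s q → 2 * s + q) ∑-floor q≡ ⟩
    2 * (r * S + g) + (1 + r * a)                      ≡⟨ lemma₁ r S g a ⟩
    r * (2 * S + a) + (1 + g * 2)                      ≡⟨ cong (r * (2 * S + a) +_) a≡1+2g ⟨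
    r * (2 * S + a) + a                                ≡⟨ cong (λ s → r * s + a) (∑-id a) ⟩
    r * (a * a) + a                                    ≡⟨ lemma₂ r a ⟩
    (1 + r * a) * a                                    ≡⟨ cong (_* a) q≡ ⟨
    q * a                                              ∎
    where
    open ≡-Reasoning
    S = ∑ a (λ t → t)
    q≡ : q ≡ 1 + r * a
    q≡ = suc-injective Q≡2+ra
    lemma₁ : ∀ r s g a → 2 * (r * s + g) + (1 + r * a) ≡ r * (2 * s + a) + (1 + g * 2)
    lemma₁ = solve-∀
    lemma₂ : ∀ r a → r * (a * a) + a ≡ (1 + r * a) * a
    lemma₂ = solve-∀

  -- Row lengths and their sum.

  bound width : ℕ → ℕ
  bound t = q ⊓ floor t
  width t = bound t ∸ L t

  -- The gap (q + 1)t − ac with c = L t + 1 + j; the subtraction is not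
  -- truncated when j < width t.
  entry : ℕ → ℕ → ℕ
  entry t j = Q * t ∸ a * suc (L t + j)

  -- Together with `bound⁻`: `bound t` is the largest `c ≤ q` for which `Q * t` minus `a * c` is
  -- still nonnegative.
  bound⁺ : ∀ {c t} → c ≤ q → a * c ≤ Q * t → c ≤ bound t
  bound⁺ {c} {t} c≤q ac≤Qt = ⊓-glb c≤q
    (subst (_≤ floor t) (trans (cong (_/ a) (*-comm a c)) (m*n/n≡m c a)) (/-monoˡ-≤ a ac≤Qt))

  bound⁻ : ∀ {c t} → c ≤ bound t → c ≤ q × a * c ≤ Q * t
  bound⁻ {c} {t} c≤ = m≤n⊓o⇒m≤n q (floor t) c≤ ,
    ≤-trans (≤-reflexive (*-comm a c)) (≤-trans (*-monoˡ-≤ a (m≤n⊓o⇒m≤o q (floor t) c≤)) (m/n*n≤m (Q * t) a))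

  -- Ensures that the subtraction in `width` is not truncated below `T`.
  L≤bound : ∀ t → t < T → L t ≤ bound t
  L≤bound t t<T = bound⁺ (subst (L t ≤_) L[T]≡q (L-mono (<⇒≤ t<T))) (≤-trans (a*L≤ t) (m≤m+n t (q * t)))

  -- The cap `q` takes over exactly at `t = a`: `floor t` is at most `q` before and at least `Q`
  -- from there on.
  ∑-bound : ∑ T bound ≡ ∑ a floor + suc (a * q) * q
  ∑-bound = begin
    ∑ T bound                                          ≡⟨ cong (λ m → ∑ m bound) (lemma a (a * q)) ⟩
    ∑ (a + suc (a * q)) bound                          ≡⟨ ∑-split a (suc (a * q)) bound ⟩
    ∑ a bound + ∑ (suc (a * q)) (λ i → bound (a + i))  ≡⟨ cong₂ _+_ (∑-cong a low) (∑-cong (suc (a * q)) high) ⟩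
    ∑ a floor + ∑ (suc (a * q)) (λ _ → q)              ≡⟨ cong (∑ a floor +_) (∑-const (suc (a * q)) q) ⟩
    ∑ a floor + suc (a * q) * q                        ∎
    where
    open ≡-Reasoning
    lemma : ∀ a y → y + (1 + a) ≡ a + (1 + y)
    lemma = solve-∀
    low : ∀ t → t < a → bound t ≡ floor t
    low t t<a = m≥n⇒m⊓n≡n (s≤s⁻¹ (m<n*o⇒m/o<n {n = Q} {o = a} (*-monoʳ-< Q t<a)))
    high : ∀ i → i < suc (a * q) → bound (a + i) ≡ q
    high i _ = m≤n⇒m⊓n≡m (≤-trans (n≤1+n q)
      (subst (_≤ floor (a + i)) (m*n/n≡m Q a) (/-monoˡ-≤ a (*-monoʳ-≤ Q (m≤m+n a i)))))

  ∑-width : ∑ T width + ∑L T ≡ ∑ a floor + suc (a * q) * q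
  ∑-width = begin
    ∑ T width + ∑L T                  ≡⟨ ∑-+ T width L ⟨
    ∑ T (λ t → width t + L t)         ≡⟨ ∑-cong T (λ t t<T → m∸n+n≡m (L≤bound t t<T)) ⟩
    ∑ T bound                         ≡⟨ ∑-bound ⟩
    ∑ a floor + suc (a * q) * q       ∎
    where open ≡-Reasoning

  2∑-width : ∀ e → e + 1 ≡ a * n → ∑ T width * 2 ≡ b * 2 + (q * q * a + q * e)
  -- The cancelled term is the right side of `∑L-T` plus the `q` needed by `2∑-floor`.
  2∑-width e e+1≡an = +-cancelʳ-≡ (a * q * Q + 3 * q) _ _ (begin
    G * 2 + (a * q * Q + 3 * q)                                    ≡⟨ lemma₁ G (a * q * Q) q ⟩
    G * 2 + (a * q * Q + 2 * q) + q                                ≡⟨ cong (λ s → G * 2 + s + q) ∑L-T ⟨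
    G * 2 + (2 * ∑L T + a * q * n + 2 * b) + q                     ≡⟨ lemma₂ G (∑L T) (a * q * n) b q ⟩
    2 * (G + ∑L T) + q + a * q * n + 2 * b                         ≡⟨ cong (λ s → 2 * s + q + a * q * n + 2 * b) ∑-width ⟩
    2 * (∑ a floor + (1 + a * q) * q) + q + a * q * n + 2 * b      ≡⟨ lemma₃ (∑ a floor) a q n b ⟩
    (2 * ∑ a floor + q) + 2 * ((1 + a * q) * q) + q * (a * n) + 2 * b
      ≡⟨ cong₂ (λ s y → s + 2 * ((1 + a * q) * q) + q * y + 2 * b) 2∑-floor (sym e+1≡an) ⟩
    q * a + 2 * ((1 + a * q) * q) + q * (e + 1) + 2 * b            ≡⟨ lemma₄ q a e b ⟩
    b * 2 + (q * q * a + q * e) + (a * q * Q + 3 * q)              ∎)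
    where
    open ≡-Reasoning
    G = ∑ T width
    lemma₁ : ∀ G y q → G * 2 + (y + 3 * q) ≡ G * 2 + (y + 2 * q) + q
    lemma₁ = solve-∀
    lemma₂ : ∀ G s y b q → G * 2 + (2 * s + y + 2 * b) + q ≡ 2 * (G + s) + q + y + 2 * b
    lemma₂ = solve-∀
    lemma₃ : ∀ f a q n b → 2 * (f + (1 + a * q) * q) + q + a * q * n + 2 * b ≡ (2 * f + q) + 2 * ((1 + a * q) * q) + q * (a * n) + 2 * b
    lemma₃ = solve-∀
    lemma₄ : ∀ q a e b → q * a + 2 * ((1 + a * q) * q) + q * (e + 1) + 2 * b ≡ b * 2 + (q * q * a + q * e) + (a * q * (1 + q) + 3 * q)
    lemma₄ = solve-∀

  -- The rows list exactly the gaps.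

  c≤bound : ∀ {t j} → j < width t → suc (L t + j) ≤ bound t
  c≤bound {t} {j} j< = subst (_≤ bound t) (cong suc (+-comm j (L t))) (m≤o∸n⇒m+n≤o (suc j) (<⇒≤ (m<n∸o⇒o<n j<)) j<)
    where
    m<n∸o⇒o<n : ∀ {m n o} → m < n ∸ o → o < n
    m<n∸o⇒o<n {m} {n} {o} h = m∸n≢0⇒n<m (λ eq → n≮0 (subst (m <_) eq h))

  c≤q : ∀ {t j} → j < width t → suc (L t + j) ≤ q
  c≤q {t} j< = proj₁ (bound⁻ {t = t} (c≤bound {t} j<))

  entry-representation : ∀ {t j} → j < width t → entry t j + a * suc (L t + j) ≡ Q * t
  entry-representation {t} j< = m∸n+n≡m (proj₂ (bound⁻ {t = t} (c≤bound {t} j<)))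

  -- Both coefficients are at most `q`, so `reduce` can only return `l = 0`.
  entry-injective : ∀ {t t′ j j′} → j < width t → j′ < width t′ → entry t j ≡ entry t′ j′ → t ≡ t′ × j ≡ j′
  entry-injective {t} {t′} {j} {j′} j< j′< eq
    with reduce (suc (L t + j)) (suc (L t′ + j′)) (c≤q {t} j<)
           (entry-representation {t} j<) (trans (cong (_+ a * suc (L t′ + j′)) eq) (entry-representation {t′} j′<))
  ... | zero , c≡ , t≡ = t≡t′ , +-cancelˡ-≡ (L t) j j′ (begin
          L t + j        ≡⟨ suc-injective (trans c≡ (+-identityʳ _)) ⟨
          L t′ + j′      ≡⟨ cong (λ t → L t + j′) t≡t′ ⟨
          L t + j′       ∎)
    where
    open ≡-Reasoning
    t≡t′ : t ≡ t′
    t≡t′ = sym (trans t≡ (trans (cong (t +_) (*-zeroʳ a)) (+-identityʳ t)))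
  ... | suc l , c≡ , _ = contradiction (subst (_≤ q) c≡ (c≤q {t′} j′<))
          (<⇒≱ (≤-trans (m≤m+n Q (l * Q)) (m≤n+m (Q + l * Q) (suc (L t + j)))))

  -- Membership would give a representation with `c ≤ L m`; `L-reduce` carries this bound back to
  -- row `t`, where the coefficient exceeds `L t`.
  entry∉SC⁺ : ∀ {t j} → j < width t → entry t j ∉ SC⁺ b n
  entry∉SC⁺ {t} {j} j< x∈ with m , c , eq , c≤ ← ∈SC⁺⁻ x∈
    with l , refl , refl ← reduce (suc (L t + j)) c (c≤q {t} j<) (entry-representation {t} j<) eq =
      contradiction (L-reduce t l (c≤q {t} j<) c≤) (<⇒≱ (s≤s (m≤m+n (L t) j)))

  ∉SC⁺⇒∈rows : ∀ {x} → x ∉ SC⁺ b n → x ∈ₗ rows width entry T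
  ∉SC⁺⇒∈rows {x} x∉ with representation x
  ... | t , c , c≤q , eq with c ≤? L t
  ...   | yes c≤ = contradiction (∈SC⁺⁺ t c eq c≤) x∉
  ...   | no  c≰ with j , refl ← m≤n⇒∃+ (≰⇒> c≰) =
    subst (_∈ₗ rows width entry T) entry≡x (∈-rows⁺ width entry t<T j<)
    where
    entry≡x : entry t j ≡ x
    entry≡x = trans (cong (_∸ a * suc (L t + j)) (sym eq)) (m+n∸n≡m x (a * suc (L t + j)))
    t<T : t < T
    -- From `T` on, `L t` is at least `L T = q`, leaving no `c ≤ q` above it.
    t<T = ≰⇒> λ T≤t → <⇒≱ (≤-trans (s≤s (m≤m+n (L t) j)) c≤q) (subst (_≤ L t) L[T]≡q (L-mono T≤t))
    j< : j < width t
    j< = m+n≤o⇒m≤o∸n (suc j) (subst (_≤ bound t) (cong suc (+-comm (L t) j))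
           (bound⁺ c≤q (≤-trans (m≤n+m (a * suc (L t + j)) x) (≤-reflexive eq))))

  hasGenus : HasGenus (SC⁺ b n) (∑ T width)
  hasGenus = rows width entry T , rows-unique width entry (λ {t} {t′} → entry-injective {t} {t′}) T ,
    length-rows width entry T , λ x → mk⇔
      (λ x∈ x∈S → let t , j , t<T , j< , x≡ = ∈-rows⁻ width entry T x∈ in
        entry∉SC⁺ {t} j< (subst (_∈ SC⁺ b n) x≡ x∈S))
      ∉SC⁺⇒∈rows

  genus≡ : ∑ T width ≡ b + (b ^ (2 * n) * a + q * (b * n ∸ n ∸ 1)) / 2
  genus≡ = begin
    ∑ T width                                  ≡⟨ m*n/n≡m (∑ T width) 2 ⟨
    ∑ T width * 2 / 2                          ≡⟨ cong (_/ 2) (2∑-width e e+1≡an) ⟩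
    (b * 2 + (q * q * a + q * e)) / 2          ≡⟨ +-distrib-/-∣ˡ (q * q * a + q * e) (n∣m*n b) ⟩
    b * 2 / 2 + (q * q * a + q * e) / 2        ≡⟨ cong (_+ (q * q * a + q * e) / 2) (m*n/n≡m b 2) ⟩
    b + (q * q * a + q * e) / 2                ≡⟨ cong (λ y → b + (y * a + q * e) / 2) b^2n≡qq ⟨
    b + (b ^ (2 * n) * a + q * e) / 2          ∎
    where
    open ≡-Reasoning
    e = b * n ∸ n ∸ 1
    -- The final `∸ 1` is not truncated, since `a` and `n` are positive.
    e+1≡an : e + 1 ≡ a * n
    e+1≡an = trans (cong (λ y → y ∸ 1 + 1) (m+n∸m≡n n (a * n)))
      (m∸n+n≡m (*-mono-≤ (>-nonZero⁻¹ a) (<⇒≤ 2≤n)))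
    b^2n≡qq : b ^ (2 * n) ≡ q * q
    b^2n≡qq = trans (^-distribˡ-+-* b n (n + 0)) (cong (λ m → q * b ^ m) (+-identityʳ n))

mainTheorem18 : (b n : ℕ) → 2 ≤ b → 2 ∣ b → 2 ≤ n →
    HasGenus (SC⁺ b n) (b + (b ^ (2 * n) * (b ∸ 1) + b ^ n * (b * n ∸ n ∸ 1)) / 2)
-- Evenness reads `suc a ≡ suc g * 2`, whose predecessor is `a ≡ 1 + g * 2`.
mainTheorem18 (suc a@(suc _)) n 2≤b (divides (suc g) b≡) 2≤n = subst (HasGenus (SC⁺ (suc a) n)) genus≡ hasGenus
  where open Gaps a g n (suc-injective b≡) 2≤n
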